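{- For all positive integers $k$ and $d$, there is a graph $G$ that is the union of $d$ comparability graphs such that $\omega(G)=k$ and $\chi(G)=k^d$.
   Context: Graphs are finite and simple. For a graph $G$, $\omega(G)$ denotes the clique number (the maximum size of a clique in $G$) and $\chi(G)$ denotes the chromatic number. A graph $G$ is the union of graphs $G_1,\ldots,G_d$ if $V(G)=V(G_1)\cup\cdots\cup V(G_d)$ and $E(G)=E(G_1)\cup\cdots\cup E(G_d)$. A comparability graph is a graph whose vertex set is a partially ordered set $(P,\preceq)$, where two (distinct) vertices are adjacent if and only if they are comparable in $(P,\preceq)$. -}

module Defs where

open import Data.Fin.Base using (Fin)
open import Data.Fin.Subset using (Subset; _∈_; _⊆_; ∣_∣)
open import Data.Nat.Base using (ℕ; _≤_)
open import Data.Product.Base using (Σ; ∃; _×_; proj₁)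
open import Data.Sum.Base using (_⊎_)
open import Function.Bundles using (_⇔_)
open import Level using (0ℓ)
open import Relation.Binary.Core using (Rel)
open import Relation.Binary.Definitions using (Decidable; Irreflexive; Symmetric)
open import Relation.Binary.PropositionalEquality using (_≡_; _≢_)
open import Relation.Binary.Structures using (IsPartialOrder)

-- Finite simple graphs whose vertices are drawn from the common pool Fin n.
-- The vertex set may be any subset of the pool, so that graphs with different
-- vertex sets can be compared and united.
record Graph (n : ℕ) : Set₁ where
  field
    V          : Subset n
    Adj        : Rel (Fin n) 0ℓ
    Adj?       : Decidable Adj
    Adj-sym    : Symmetric Adj
    Adj-irrefl : Irreflexive _≡_ Adj
    Adj⇒∈V     : ∀ {x y} → Adj x y → x ∈ V

  Vertex : Set
  Vertex = Σ (Fin n) (_∈ V)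

  _~_ : Rel Vertex 0ℓ
  u ~ v = Adj (proj₁ u) (proj₁ v)

open Graph

IsUnion : ∀ {n d} → (Fin d → Graph n) → Graph n → Set
IsUnion H G =
  (∀ x → x ∈ V G ⇔ ∃ λ i → x ∈ V (H i)) ×
  (∀ x y → Adj G x y ⇔ ∃ λ i → Adj (H i) x y)

IsComparabilityGraph : ∀ {n} → Graph n → Set₁
IsComparabilityGraph G =
  Σ (Rel (Vertex G) 0ℓ) λ _≼_ →
    IsPartialOrder _≡_ _≼_ ×
    (∀ u v → _~_ G u v ⇔ (u ≢ v × (u ≼ v ⊎ v ≼ u)))

IsUnionOfComparabilityGraphs : ∀ {n} → ℕ → Graph n → Set₁
IsUnionOfComparabilityGraphs {n} d G =
  Σ (Fin d → Graph n) λ H →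
    (∀ i → IsComparabilityGraph (H i)) × IsUnion H G

IsClique : ∀ {n} → Graph n → Subset n → Set
IsClique G S =
  S ⊆ V G × (∀ {x y} → x ∈ S → y ∈ S → x ≢ y → Adj G x y)

-- ω(G) = k
IsCliqueNumber : ∀ {n} → Graph n → ℕ → Set
IsCliqueNumber G k =
  (∃ λ S → IsClique G S × ∣ S ∣ ≡ k) ×
  (∀ S → IsClique G S → ∣ S ∣ ≤ k)

Colourable : ∀ {n} → Graph n → ℕ → Set
Colourable G c =
  Σ (Vertex G → Fin c) λ f → ∀ u v → _~_ G u v → f u ≢ f v

-- χ(G) = c
IsChromaticNumber : ∀ {n} → Graph n → ℕ → Set
IsChromaticNumber G c =
  Colourable G c × (∀ c′ → Colourable G c′ → c ≤ c′)

{-# OPTIONS --safe #-}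

-- A system of d orders whose comparability graphs are to be united is turned
-- into a system of d + 1 orders with k times as many forced colours.  The new
-- order has k levels, each a disjoint union of copies of the old system, and
-- is arranged so that no vertex is comparable to two vertices of one copy that
-- are adjacent there.  Hence every triangle, and so every clique, lies either
-- in one copy or in one chain of the new order.  If the vertices of a copy on
-- level j + 1 are all above vertices of the same j * m colours, then the copy
-- uses m further colours; by the pigeonhole principle this can be repeated
-- on the next level.
module Submission where

open import Defs
open import Data.Fin.Base
  using (Fin; zero; suc; combine; splitAt; inject≤; finToFun; funToFin)
import Data.Fin.Base as Fin
open import Data.Fin.Properties
  using (_≟_; any?; all?; ¬∀⟶∃¬; 0↔⊥; 1↔⊤; +↔⊎; *↔×; combine-injective;
         finToFun-funToFin; injective⇒≤; inject≤-injective; inj⇒≟; join-splitAt;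
         <-cmp; <-irrefl; <-trans; _<?_; suc-injective)
open import Data.Fin.Subset using (Subset; inside; outside; _∈_; ∣_∣)
import Data.Fin.Subset as Subset
open import Data.Fin.Subset.Properties
  using (∈⊤; x∈p⇒∣p-x∣<∣p∣; x∈p∧x≢y⇒x∈p-y)
open import Data.Nat.Base using (ℕ; zero; suc; NonZero; _+_; _*_; _^_; _≤_; z≤n; s≤s)
import Data.Nat.Properties as ℕ
open import Data.Empty using (⊥)
open import Data.Product.Base using (Σ; ∃; _×_; _,_; proj₁; proj₂)
open import Data.Product.Function.NonDependent.Propositional using (_×-↔_)
open import Data.Sum.Base using (_⊎_; inj₁; inj₂; [_,_]′; swap)
open import Data.Sum.Function.Propositional using (_⊎-↔_)
open import Data.Unit.Base using (⊤; tt)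
open import Data.Vec.Base using ([]; _∷_; tabulate; here; there)
open import Data.Vec.Properties using (lookup∘tabulate; []=⇒lookup; lookup⇒[]=)
open import Function.Base using (id; _∘_)
open import Function.Bundles using (_↔_; mk⇔; Inverse)
open import Function.Definitions using (Injective)
open import Function.Properties.Inverse using (↔-refl; ↔-sym; ↔-trans; ↔⇒↣)
open import Level using (0ℓ)
open import Relation.Binary.Core using (Rel)
open import Relation.Binary.Definitions
  using (Decidable; DecidableEquality; Symmetric; Transitive; tri<; tri≈; tri>)
open import Relation.Binary.PropositionalEquality
  using (_≡_; _≢_; refl; sym; trans; cong; subst; subst₂; resp₂; isEquivalence)
open import Relation.Binary.Structures using (IsStrictPartialOrder)
import Relation.Binary.Construct.StrictToNonStrict as StrictToNonStrict
open import Relation.Nullary using (Dec; yes; no; ¬_; does; contradiction)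
open import Relation.Nullary.Decidable using (map′; _×-dec_; _⊎-dec_; dec-true; decidable-stable)

private variable
  A B E : Set

-- Finite types

Finite : Set → Set
Finite A = ∃ λ n → A ↔ Fin n

finite-Fin : ∀ n → Finite (Fin n)
finite-Fin n = n , ↔-refl

finite-⊎ : Finite A → Finite B → Finite (A ⊎ B)
finite-⊎ (_ , f) (_ , g) = _ , ↔-trans (f ⊎-↔ g) (↔-sym +↔⊎)

finite-× : Finite A → Finite B → Finite (A × B)
finite-× (_ , f) (_ , g) = _ , ↔-trans (f ×-↔ g) (↔-sym *↔×)

finite-≟ : Finite A → DecidableEquality A
finite-≟ (_ , f) = inj⇒≟ (↔⇒↣ f)

-- If every letter q had a value i q such that no word taking this value at q
-- is sent to q, then the word i would contradict itself at the letter F i.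
diagonal : ∀ M Q (F : Fin (M ^ Q) → Fin Q) →
           ∃ λ q → ∀ i → ∃ λ ν → finToFun {M} {Q} ν q ≡ i × F ν ≡ q
diagonal M Q F = decidable-stable (any? λ q → all? (Hit? q)) λ none →
  let miss q = ¬∀⟶∃¬ M (Hit q) (Hit? q) (λ all → none (q , all))
      ν      = funToFin (proj₁ ∘ miss)
  in  proj₂ (miss (F ν)) (ν , finToFun-funToFin (proj₁ ∘ miss) (F ν) , refl)
  where
  Hit : Fin Q → Fin M → Set
  Hit q i = ∃ λ ν → finToFun {M} {Q} ν q ≡ i × F ν ≡ q

  Hit? : ∀ q i → Dec (Hit q i)
  Hit? q i = any? λ ν → (finToFun {M} {Q} ν q ≟ i) ×-dec (F ν ≟ q)

-- Cliques

Comparable : Rel A 0ℓ → Rel A 0ℓ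
Comparable R x y = R x y ⊎ R y x

Joined : (E → Rel A 0ℓ) → Rel A 0ℓ
Joined R x y = ∃ λ e → Comparable (R e) x y

Joined-sym : (R : E → Rel A 0ℓ) → Symmetric (Joined R)
Joined-sym R (e , r) = e , swap r

Proper : (E → Rel A 0ℓ) → (A → B) → Set
Proper R f = ∀ {e x y} → R e x y → f x ≢ f y

joined⇒≢ : {R : E → Rel A 0ℓ} (f : A → B) → Proper R f → ∀ {x y} → Joined R x y → f x ≢ f y
joined⇒≢ f f-proper (_ , inj₁ r) = f-proper r
joined⇒≢ f f-proper (_ , inj₂ r) = f-proper r ∘ sym

Pairwise : ∀ {n} → Rel A 0ℓ → (Fin n → A) → Set
Pairwise R v = ∀ a b → a ≢ b → R (v a) (v b)

pairwise-injective : ∀ {n} {R : Rel A 0ℓ} (v : Fin n → A) (f : A → B) →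
                     (∀ {x y} → R x y → f x ≢ f y) → Pairwise R v →
                     Injective _≡_ _≡_ (f ∘ v)
pairwise-injective v f R⇒≢ vR {a} {b} fa≡fb =
  decidable-stable (a ≟ b) λ a≢b → R⇒≢ (vR a b a≢b) fa≡fb

module _ {P Q : Rel A 0ℓ} (P-sym : Symmetric P) (Q-sym : Symmetric Q)
         (no-mixed : ∀ {x y z} → P x y → Q y z → P x z ⊎ Q x z → ⊥) where

  -- A `Q`-edge at `v zero` would form a mixed triangle with the edge `p₀₁`, so `P` spreads to all
  -- edges at `v zero`, and from these to all others in the same way.
  pairwise-spread : ∀ {n} (v : Fin (2 + n) → A) → Pairwise (λ x y → P x y ⊎ Q x y) v →
                    P (v zero) (v (suc zero)) → Pairwise P v
  pairwise-spread v vPQ p₀₁ = spread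
    where
    from-zero : ∀ b → zero ≢ b → P (v zero) (v b)
    from-zero b 0≢b with vPQ zero b 0≢b | b ≟ suc zero
    ... | inj₁ p | _        = p
    ... | inj₂ q | yes refl = p₀₁
    ... | inj₂ q | no b≢1   with () ← no-mixed (P-sym p₀₁) q (vPQ _ _ (b≢1 ∘ sym))

    spread : Pairwise P v
    spread zero    b       a≢b = from-zero b a≢b
    spread (suc a) zero    a≢b = P-sym (from-zero (suc a) (a≢b ∘ sym))
    spread (suc a) (suc b) a≢b with vPQ _ _ a≢b
    ... | inj₁ p = p
    ... | inj₂ q with () ← no-mixed (from-zero (suc a) (λ ())) q (vPQ zero (suc b) (λ ()))

pairwise-split : ∀ {P Q : Rel A 0ℓ} → Symmetric P → Symmetric Q →
                 (∀ {x y z} → P x y → Q y z → P x z ⊎ Q x z → ⊥) →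
                 ∀ {n} (v : Fin n → A) → Pairwise (λ x y → P x y ⊎ Q x y) v →
                 Pairwise P v ⊎ Pairwise Q v
pairwise-split _     _     _        {0}           v vPQ = inj₁ λ ()
pairwise-split _     _     _        {1}           v vPQ =
  inj₁ λ { zero zero 0≢0 → contradiction refl 0≢0 }
pairwise-split {P = P} {Q} P-sym Q-sym no-mixed {suc (suc _)} v vPQ with vPQ zero (suc zero) (λ ())
... | inj₁ p = inj₁ (pairwise-spread {P = P} {Q} P-sym Q-sym no-mixed v vPQ p)
-- With `P` and `Q` exchanged, the triangle is read from its other end.
... | inj₂ q = inj₂ (pairwise-spread {P = Q} {P} Q-sym P-sym
    (λ q p s → no-mixed (P-sym p) (Q-sym q) ([ inj₂ ∘ Q-sym , inj₁ ∘ P-sym ]′ s))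
    v (λ a b → swap ∘ vPQ a b) q)

splitAt-injective : ∀ {m n} (f : Fin m → A) (g : Fin n → A) →
                    Injective _≡_ _≡_ f → Injective _≡_ _≡_ g → (∀ a b → f a ≢ g b) →
                    Injective _≡_ _≡_ ([ f , g ]′ ∘ splitAt m)
splitAt-injective {m = m} {n} f g f-inj g-inj f≢g {x} {y} eq =
  trans (sym (join-splitAt m n x))
        (trans (cong (Fin.join m n) (split (splitAt m x) (splitAt m y) eq)) (join-splitAt m n y))
  where
  split : ∀ u v → [ f , g ]′ u ≡ [ f , g ]′ v → u ≡ v
  split (inj₁ a) (inj₁ b) eq = cong inj₁ (f-inj eq)
  split (inj₁ a) (inj₂ b) eq = contradiction eq (f≢g a b)
  split (inj₂ a) (inj₁ b) eq = contradiction (sym eq) (f≢g b a)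
  split (inj₂ a) (inj₂ b) eq = cong inj₂ (g-inj eq)

-- The towers are built against colourings with a fixed number c of colours.
module Construction (k′ c : ℕ) (c₀ : Fin c) where

  private
    k : ℕ
    k = suc k′

  -- `forcing` yields vertices that carry the distinct colours, because the ports built later record
  -- such a choice of vertices. `point` keeps the system inhabited, and its colour gives an element
  -- of `Fin m`.
  record System (d m : ℕ) : Set₁ where
    field
      n             : ℕ
      R             : Fin d → Rel (Fin n) 0ℓ
      R?            : ∀ e → Decidable (R e)
      R-irrefl      : ∀ {e x} → ¬ R e x x
      R-trans       : ∀ {e} → Transitive (R e)
      point         : Fin n
      colour        : Fin n → Fin m
      colour-proper : Proper R colour
      forcing       : (f : Fin n → Fin c) → Proper R f →
                      ∃ λ (y : Fin m → Fin n) → Injective _≡_ _≡_ (f ∘ y)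
      clique        : ∃ λ (v : Fin k → Fin n) → Pairwise (Joined R) v
      clique-bound  : (v : Fin (suc k) → Fin n) → ¬ Pairwise (Joined R) v

  -- Towers of copies of a system

  module _ {d m : ℕ} (S : System d m) where
    private module S = System S

    -- Levels are counted from the top.  A port is a place where a copy of S can
    -- be put on top of the tower, with its vertex x above all Under p x.
    record Tower (j : ℕ) : Set₁ where
      field
        Point         : Set
        Port          : Set
        finite-Point  : Finite Point
        finite-Port   : Finite Port
        port          : Port
        R             : Fin (suc d) → Rel Point 0ℓ
        R?            : ∀ e → Decidable (R e)
        R-trans       : ∀ {e} → Transitive (R e)
        Under         : Port → Fin S.n → Point → Set
        Under?        : ∀ p x t → Dec (Under p x t)
        Under-closed  : ∀ {p x s t} → R zero s t → Under p x t → Under p x s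
        level         : Point → Fin j
        level-<       : ∀ {s t} → R zero s t → level t Fin.< level s
        level-≡       : ∀ {e s t} → R (suc e) s t → level s ≡ level t
        proj          : Point → Fin S.n
        proj-R        : ∀ {e s t} → R (suc e) s t → S.R e (proj s) (proj t)
        below-indep   : ∀ {e r s t} → R zero r s → R zero r t → ¬ R (suc e) s t
        above-indep   : ∀ {e r s t} → R zero s r → R zero t r → ¬ R (suc e) s t
        Under-indep   : ∀ {e p x s t} → Under p x s → Under p x t → ¬ R (suc e) s t
        Under-unique  : ∀ {p x y t} → Under p x t → Under p y t → x ≡ y
        -- The port and the list `s` do not depend on `x`: all vertices of a copy put on `p` avoid
        -- the same `j * m` colours.
        forcing       : (f : Point → Fin c) → Proper R f →
                        ∃ λ p → ∃ λ (s : Fin (j * m) → Fin c) → Injective _≡_ _≡_ s ×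
                        (∀ x b → ∃ λ t → Under p x t × f t ≡ s b)

    -- A single port with nothing under it, so that the first level consists of plain copies of the
    -- system. As `0 * m` is 0, no colour is forced yet.
    emptyTower : Tower 0
    emptyTower = record
      { Point        = ⊥
      ; Port         = ⊤
      ; finite-Point = 0 , ↔-sym 0↔⊥
      ; finite-Port  = 1 , ↔-sym 1↔⊤
      ; port         = tt
      ; R            = λ _ ()
      ; R?           = λ _ ()
      ; R-trans      = λ { {_} {()} }
      ; Under        = λ _ _ ()
      ; Under?       = λ _ _ ()
      ; Under-closed = λ { {s = ()} }
      ; level        = λ ()
      ; level-<      = λ { {()} }
      ; level-≡      = λ { {_} {()} }
      ; proj         = λ ()
      ; proj-R       = λ { {_} {()} }
      ; below-indep  = λ { {_} {()} }
      ; above-indep  = λ { {_} {()} }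
      ; Under-indep  = λ { {s = ()} }
      ; Under-unique = λ { {t = ()} }
      ; forcing      = λ _ _ → tt , (λ ()) , (λ { {()} }) , λ _ ()
      }

    -- Adding a level on top

    module Extend {j : ℕ} (T : Tower j) where
      private module T = Tower T

      -- All ports are filled at once, because the port singled out by `T.forcing` depends on the
      -- colouring.
      Block : Set
      Block = T.Point ⊎ (T.Port × Fin S.n)

      data BlockR : Fin (suc d) → Rel Block 0ℓ where
        old   : ∀ {e s t} → T.R e s t → BlockR e (inj₁ s) (inj₁ t)
        under : ∀ {p x t} → T.Under p x t → BlockR zero (inj₁ t) (inj₂ (p , x))
        new   : ∀ {e p x y} → S.R e x y → BlockR (suc e) (inj₂ (p , x)) (inj₂ (p , y))

      finite-Block : Finite Block
      finite-Block = finite-⊎ T.finite-Point (finite-× T.finite-Port (finite-Fin S.n))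

      _≟ᴮ_ : DecidableEquality Block
      _≟ᴮ_ = finite-≟ finite-Block

      blockR? : ∀ e → Decidable (BlockR e)
      blockR? e       (inj₁ s)       (inj₁ t)       =
        map′ old (λ { (old r) → r }) (T.R? e s t)
      blockR? zero    (inj₁ t)       (inj₂ (p , x)) =
        map′ under (λ { (under u) → u }) (T.Under? p x t)
      blockR? (suc e) (inj₁ _)       (inj₂ _)       = no λ ()
      blockR? e       (inj₂ _)       (inj₁ _)       = no λ ()
      blockR? zero    (inj₂ _)       (inj₂ _)       = no λ ()
      blockR? (suc e) (inj₂ (p , x)) (inj₂ (q , y)) with finite-≟ T.finite-Port p q
      ... | yes refl = map′ new (λ { (new r) → r }) (S.R? e x y)
      ... | no p≢q   = no λ { (new _) → p≢q refl }

      blockR-trans : ∀ {e} → Transitive (BlockR e)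
      blockR-trans (old r) (old s)   = old (T.R-trans r s)
      blockR-trans (old r) (under u) = under (T.Under-closed r u)
      blockR-trans (new r) (new s)   = new (S.R-trans r s)

      blockLevel : Block → Fin (suc j)
      blockLevel (inj₁ t) = suc (T.level t)
      blockLevel (inj₂ _) = zero

      blockLevel-< : ∀ {u v} → BlockR zero u v → blockLevel v Fin.< blockLevel u
      blockLevel-< (old r)   = s≤s (T.level-< r)
      blockLevel-< (under _) = s≤s z≤n

      blockLevel-≡ : ∀ {e u v} → BlockR (suc e) u v → blockLevel u ≡ blockLevel v
      blockLevel-≡ (old r) = cong suc (T.level-≡ r)
      blockLevel-≡ (new _) = refl

      blockProj : Block → Fin S.n
      blockProj (inj₁ t)       = T.proj t
      blockProj (inj₂ (_ , x)) = x

      blockProj-R : ∀ {e u v} → BlockR (suc e) u v → S.R e (blockProj u) (blockProj v)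
      blockProj-R (old r) = T.proj-R r
      blockProj-R (new r) = r

      -- Two vertices of new copies that are adjacent in an old order belong to the same port;
      -- `Under-unique` then makes them equal.
      block-below-indep : ∀ {e u v w} → BlockR zero u v → BlockR zero u w → ¬ BlockR (suc e) v w
      block-below-indep (old r)   (old s)   (old t) = T.below-indep r s t
      block-below-indep (under u) (under v) (new t)
        with refl ← T.Under-unique u v = S.R-irrefl t

      -- If `u` belongs to a new copy, then `v` and `w` are under one vertex of one port, and
      -- `T.Under-indep` applies.
      block-above-indep : ∀ {e u v w} → BlockR zero v u → BlockR zero w u → ¬ BlockR (suc e) v w
      block-above-indep (old r)   (old s)   (old t) = T.above-indep r s t
      block-above-indep (under u) (under v) (old t) = T.Under-indep u v t

      block-irrefl : ∀ {e u} → ¬ BlockR (suc e) u u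
      block-irrefl r = S.R-irrefl (blockProj-R r)

      _≤ᴮ_ : Rel Block 0ℓ
      u ≤ᴮ v = u ≡ v ⊎ BlockR zero u v

      -- Adding `u` to its own down-set is harmless: what is strictly below it lies on other levels,
      -- while the old orders stay within a level.
      block-≤-indep : ∀ {e u v w} → v ≤ᴮ u → w ≤ᴮ u → ¬ BlockR (suc e) v w
      block-≤-indep (inj₁ refl) (inj₁ refl) t = block-irrefl t
      block-≤-indep (inj₁ refl) (inj₂ s)    t =
        <-irrefl (blockLevel-≡ t) (blockLevel-< s)
      block-≤-indep (inj₂ r)    (inj₁ refl) t =
        <-irrefl (sym (blockLevel-≡ t)) (blockLevel-< r)
      block-≤-indep (inj₂ r)    (inj₂ s)    t = block-above-indep r s t

      -- A copy of the block is numbered by a word of length Q, with a letter in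
      -- Fin M for each colouring of the block.
      M Q N : ℕ
      M = S.n * m
      Q = c ^ proj₁ finite-Block
      N = M ^ Q

      letter : Fin N → Fin Q → Fin M
      letter = finToFun {M} {Q}

      Point : Set
      Point = Fin N × Block

      data R : Fin (suc d) → Rel Point 0ℓ where
        at : ∀ {e ν u v} → BlockR e u v → R e (ν , u) (ν , v)

      R? : ∀ e → Decidable (R e)
      R? e (ν , u) (μ , v) with ν ≟ μ
      ... | yes refl = map′ at (λ { (at r) → r }) (blockR? e u v)
      ... | no ν≢μ   = no λ { (at _) → ν≢μ refl }

      -- In a port (n , q , p , y), the vertex x is put above the vertex y a of
      -- the copy of S at p in block number n (x , a).  The block numbers have to
      -- be distinct, which is achieved by having the pair (x , a) as letter q.
      Port : Set
      Port = Fin (N ^ M) × Fin Q × T.Port × Fin (S.n ^ m)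

      Under : Port → Fin S.n → Point → Set
      Under (n , q , p , y) x (ν , u) = ∃ λ (a : Fin m) →
        letter ν q ≡ combine x a ×
        finToFun {N} {M} n (combine x a) ≡ ν ×
        u ≤ᴮ inj₂ (p , finToFun {S.n} {m} y a)

      Under? : ∀ p x t → Dec (Under p x t)
      Under? (n , q , p , y) x (ν , u) = any? λ a →
        (letter ν q ≟ combine x a) ×-dec
        (finToFun {N} {M} n (combine x a) ≟ ν) ×-dec
        ((u ≟ᴮ _) ⊎-dec blockR? zero u _)

      Under-closed : ∀ {p x s t} → R zero s t → Under p x t → Under p x s
      Under-closed (at r) (a , l , n , inj₁ refl) = a , l , n , inj₂ r
      Under-closed (at r) (a , l , n , inj₂ s)    = a , l , n , inj₂ (blockR-trans r s)

      -- Adjacent points of a copy share a block number, and its letter `q` determines `a`. So both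
      -- lie below one and the same vertex of that block.
      Under-indep : ∀ {e p x s t} → Under p x s → Under p x t → ¬ R (suc e) s t
      Under-indep {x = x} (a , l , _ , u) (b , l′ , _ , v) (at r)
        with refl ← proj₂ (combine-injective x a x b (trans (sym l) l′)) = block-≤-indep u v r

      Under-unique : ∀ {p x y t} → Under p x t → Under p y t → x ≡ y
      Under-unique {x = x} {y} (a , l , _) (b , l′ , _) =
        proj₁ (combine-injective x a y b (trans (sym l) l′))

      pair₀ : Fin M
      pair₀ = combine S.point (S.colour S.point)

      module Forcing (f : Point → Fin c) (f-proper : Proper R f) where

        index : Block → Fin (proj₁ finite-Block)
        index = Inverse.to (proj₂ finite-Block)

        pattern-of : Fin N → Fin Q
        pattern-of ν = funToFin (λ i → f (ν , Inverse.from (proj₂ finite-Block) i))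

        paint : Fin Q → Block → Fin c
        paint q u = finToFun {c} {proj₁ finite-Block} q (index u)

        paint-pattern : ∀ ν u → paint (pattern-of ν) u ≡ f (ν , u)
        paint-pattern ν u =
          trans (finToFun-funToFin (λ i → f (ν , Inverse.from (proj₂ finite-Block) i)) (index u))
                (cong (λ w → f (ν , w)) (Inverse.strictlyInverseʳ (proj₂ finite-Block) u))

        -- Each block number is sent to the colouring of its block. Some colouring `q` then recurs
        -- on blocks that realise every pair `(x , a)` as letter `q`, as a port demands.
        repeated : ∃ λ q → ∀ i → ∃ λ ν → letter ν q ≡ i × pattern-of ν ≡ q
        repeated = diagonal M Q pattern-of

        q : Fin Q
        q = proj₁ repeated

        number : Fin M → Fin N
        number i = proj₁ (proj₂ repeated i)

        f≡paint : ∀ i u → f (number i , u) ≡ paint q u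
        f≡paint i u = trans (sym (paint-pattern (number i) u))
                            (cong (λ r → paint r u) (proj₂ (proj₂ (proj₂ repeated i))))

        -- The painting `q` occurs on an actual block, for instance the one numbered `number pair₀`.
        paint-proper : Proper BlockR (paint q)
        paint-proper {x = u} {v} r eq =
          f-proper (at r) (trans (f≡paint pair₀ u) (trans eq (sym (f≡paint pair₀ v))))

        -- The blocks chosen by `number` are all painted alike, so the `p` and `y` found in the
        -- painting `q` work in each of them. The vertices `y a` contribute `m` colours and the
        -- points under them `j * m` others.
        forced : ∃ λ p → ∃ λ (s : Fin (suc j * m) → Fin c) → Injective _≡_ _≡_ s ×
                 (∀ x b → ∃ λ t → Under p x t × f t ≡ s b)
        forced
          with p , s , s-inj , s-hit ← T.forcing (paint q ∘ inj₁) (λ r → paint-proper (old r))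
          with y , y-inj ← S.forcing (λ x → paint q (inj₂ (p , x))) (λ r → paint-proper (new r))
          = (funToFin number , q , p , funToFin y) , [ top , s ]′ ∘ splitAt m
          , splitAt-injective top s y-inj s-inj top≢s
          , λ x b → hit x (splitAt m b)
          where
          top : Fin m → Fin c
          top a = paint q (inj₂ (p , y a))

          -- A point of colour `s b` already lies under the vertex `y a`, hence below it in the new
          -- order.
          top≢s : ∀ a b → top a ≢ s b
          top≢s a b eq with t , u , ft≡sb ← s-hit (y a) b =
            paint-proper (under u) (trans ft≡sb (sym eq))

          y≡ : ∀ a → y a ≡ finToFun {S.n} {m} (funToFin y) a
          y≡ a = sym (finToFun-funToFin y a)

          in-block : ∀ {x} a {u} → u ≤ᴮ inj₂ (p , y a) →
                     Under (funToFin number , q , p , funToFin y) x (number (combine x a) , u)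
          in-block {x} a {u} u≤ =
            a , proj₁ (proj₂ (proj₂ repeated (combine x a)))
              , finToFun-funToFin number (combine x a)
              , subst (λ z → u ≤ᴮ inj₂ (p , z)) (y≡ a) u≤

          hit : ∀ x (b : Fin m ⊎ Fin (j * m)) → ∃ λ t →
                Under (funToFin number , q , p , funToFin y) x t × f t ≡ [ top , s ]′ b
          hit x (inj₁ a) = (number (combine x a) , inj₂ (p , y a))
                         , in-block a (inj₁ refl) , f≡paint _ _
          -- Every `y a` has all colours `s b` under it; `S.colour S.point` is just some index in
          -- `Fin m`.
          hit x (inj₂ b) with t , u , ft≡sb ← s-hit (y (S.colour S.point)) b =
            (number pair , inj₁ t) , in-block _ (inj₂ (under u)) , trans (f≡paint _ _) ft≡sb
            where
            pair : Fin M
            pair = combine x (S.colour S.point)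

      number₀ : Fin N
      number₀ = funToFin {Q} (λ _ → pair₀)

      extendedTower : Tower (suc j)
      extendedTower = record
        { Point        = Point
        ; Port         = Port
        ; finite-Point = finite-× (finite-Fin N) finite-Block
        ; finite-Port  = finite-× (finite-Fin _) (finite-× (finite-Fin _)
                           (finite-× T.finite-Port (finite-Fin _)))
        -- An arbitrary port, marking a place where a copy certainly exists.
        ; port         = funToFin {M} (λ _ → number₀)
                       , funToFin {proj₁ finite-Block} (λ _ → c₀)
                       , T.port
                       , funToFin {m} (λ _ → S.point)
        ; R            = R
        ; R?           = R?
        ; R-trans      = λ { (at r) (at s) → at (blockR-trans r s) }
        ; Under        = Under
        ; Under?       = Under?
        ; Under-closed = λ {p} → Under-closed {p}
        ; level        = blockLevel ∘ proj₂
        ; level-<      = λ { (at r) → blockLevel-< r }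
        ; level-≡      = λ { (at r) → blockLevel-≡ r }
        ; proj         = blockProj ∘ proj₂
        ; proj-R       = λ { (at r) → blockProj-R r }
        ; below-indep  = λ { (at r) (at s) (at t) → block-below-indep r s t }
        ; above-indep  = λ { (at r) (at s) (at t) → block-above-indep r s t }
        ; Under-indep  = λ {_} {p} → Under-indep {p = p}
        ; Under-unique = λ {p} → Under-unique {p}
        ; forcing      = Forcing.forced
        }

      copy : Fin S.n → Point
      copy x = number₀ , inj₂ (T.port , x)

      copy-R : ∀ {e x y} → S.R e x y → R (suc e) (copy x) (copy y)
      copy-R r = at (new r)

    tower : ∀ j → Tower j
    tower zero    = emptyTower
    tower (suc j) = Extend.extendedTower (tower j)

    -- From a tower of `k` levels to a system

    module Flatten (T : Tower k) (copy : Fin S.n → Tower.Point T)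
                   (copy-R : ∀ {e x y} → S.R e x y → Tower.R T (suc e) (copy x) (copy y)) where
      private module T = Tower T

      InChain InCopy : Rel T.Point 0ℓ
      InChain = Comparable (T.R zero)
      InCopy  = Joined (T.R ∘ suc)

      InChain⇒level-≢ : ∀ {s t} → InChain s t → T.level s ≢ T.level t
      InChain⇒level-≢ (inj₁ r) eq = <-irrefl (sym eq) (T.level-< r)
      InChain⇒level-≢ (inj₂ r) eq = <-irrefl eq (T.level-< r)

      InCopy⇒level-≡ : ∀ {s t} → InCopy s t → T.level s ≡ T.level t
      InCopy⇒level-≡ (_ , inj₁ r) = T.level-≡ r
      InCopy⇒level-≡ (_ , inj₂ r) = sym (T.level-≡ r)

      -- If `r` lies between `s` and `t`, transitivity makes these two comparable in the new order,
      -- hence of different levels, which no old order relates.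
      chain-indep : ∀ {e r s t} → InChain r s → InChain r t → ¬ T.R (suc e) s t
      chain-indep (inj₁ r<s) (inj₁ r<t) = T.below-indep r<s r<t
      chain-indep (inj₁ r<s) (inj₂ t<r) u =
        InChain⇒level-≢ (inj₂ (T.R-trans t<r r<s)) (T.level-≡ u)
      chain-indep (inj₂ s<r) (inj₁ r<t) u =
        InChain⇒level-≢ (inj₁ (T.R-trans s<r r<t)) (T.level-≡ u)
      chain-indep (inj₂ s<r) (inj₂ t<r) = T.above-indep s<r t<r

      no-mixed-triangle : ∀ {r s t} → InChain r s → InCopy s t → InChain r t ⊎ InCopy r t → ⊥
      -- Two edges inside copies would put all three vertices on one level.
      no-mixed-triangle rs st             (inj₂ rt) =
        InChain⇒level-≢ rs (trans (InCopy⇒level-≡ rt) (sym (InCopy⇒level-≡ st)))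
      no-mixed-triangle rs (_ , inj₁ s<t) (inj₁ rt) = chain-indep rs rt s<t
      no-mixed-triangle rs (_ , inj₂ t<s) (inj₁ rt) = chain-indep rt rs t<s

      chain-or-copy : ∀ {s t} → Joined T.R s t → InChain s t ⊎ InCopy s t
      chain-or-copy (zero  , r) = inj₁ r
      chain-or-copy (suc e , r) = inj₂ (e , r)

      proj-joined : ∀ {s t} → InCopy s t → Joined S.R (T.proj s) (T.proj t)
      proj-joined (e , inj₁ r) = e , inj₁ (T.proj-R r)
      proj-joined (e , inj₂ r) = e , inj₂ (T.proj-R r)

      -- A clique in a chain has distinct levels, of which there are only `k`; a clique in a copy is
      -- carried by `proj` to one of the same size in the system.
      tower-clique-bound : (v : Fin (suc k) → T.Point) → ¬ Pairwise (Joined T.R) v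
      tower-clique-bound v vJ
        with pairwise-split {P = InChain} {InCopy} swap (Joined-sym (T.R ∘ suc)) no-mixed-triangle v
               (λ a b → chain-or-copy ∘ vJ a b)
      ... | inj₁ chain  =
        ℕ.1+n≰n (injective⇒≤ (pairwise-injective {R = InChain} v T.level InChain⇒level-≢ chain))
      ... | inj₂ inCopy = S.clique-bound (T.proj ∘ v) λ a b → proj-joined ∘ inCopy a b

      private
        encode : T.Point → Fin (proj₁ T.finite-Point)
        encode = Inverse.to (proj₂ T.finite-Point)

        decode : Fin (proj₁ T.finite-Point) → T.Point
        decode = Inverse.from (proj₂ T.finite-Point)

        decode-encode : ∀ t → decode (encode t) ≡ t
        decode-encode = Inverse.strictlyInverseʳ (proj₂ T.finite-Point)

        codeR : Fin (suc d) → Rel (Fin (proj₁ T.finite-Point)) 0ℓ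
        codeR e x y = T.R e (decode x) (decode y)

        encode-R : ∀ {e s t} → T.R e s t → codeR e (encode s) (encode t)
        encode-R {e} {s} {t} = subst₂ (T.R e) (sym (decode-encode s)) (sym (decode-encode t))

      tower-colour : T.Point → Fin (k * m)
      tower-colour t = combine (T.level t) (S.colour (T.proj t))

      tower-colour-injective : ∀ {s t} → tower-colour s ≡ tower-colour t →
        T.level s ≡ T.level t × S.colour (T.proj s) ≡ S.colour (T.proj t)
      tower-colour-injective {s} {t} =
        combine-injective (T.level s) (S.colour (T.proj s)) (T.level t) (S.colour (T.proj t))

      -- The level separates the ends of an edge of the new order, and the colour of the projection
      -- those of an old one.
      tower-colour-proper : Proper T.R tower-colour
      tower-colour-proper {zero}  r eq =
        InChain⇒level-≢ (inj₁ r) (proj₁ (tower-colour-injective eq))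
      tower-colour-proper {suc e} r eq =
        S.colour-proper (T.proj-R r) (proj₂ (tower-colour-injective eq))

      tower-irrefl : ∀ {e t} → ¬ T.R e t t
      tower-irrefl r = tower-colour-proper r refl

      tower-forcing : (f : Fin (proj₁ T.finite-Point) → Fin c) → Proper codeR f →
                      ∃ λ (y : Fin (k * m) → Fin (proj₁ T.finite-Point)) → Injective _≡_ _≡_ (f ∘ y)
      tower-forcing f f-proper
        with p , s , s-inj , hit ← T.forcing (f ∘ encode) (λ r → f-proper (encode-R r))
        -- The final ports stay empty: all `k * m` colours already occur under one vertex of a port,
        -- here `S.point`.
        = (λ b → encode (proj₁ (hit S.point b)))
        , λ {a} {b} eq → s-inj (trans (sym (proj₂ (proj₂ (hit S.point a))))
                                      (trans eq (proj₂ (proj₂ (hit S.point b)))))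

      tower-clique : Pairwise (Joined codeR)
                              (encode ∘ copy ∘ proj₁ S.clique)
      tower-clique a b a≢b with proj₂ S.clique a b a≢b
      ... | e , inj₁ r = suc e , inj₁ (encode-R (copy-R r))
      ... | e , inj₂ r = suc e , inj₂ (encode-R (copy-R r))

      flattened : System (suc d) (k * m)
      flattened = record
        { n             = proj₁ T.finite-Point
        ; R             = codeR
        ; R?            = λ e x y → T.R? e (decode x) (decode y)
        ; R-irrefl      = tower-irrefl
        ; R-trans       = T.R-trans
        ; point         = encode (copy S.point)
        ; colour        = tower-colour ∘ decode
        ; colour-proper = tower-colour-proper
        ; forcing       = tower-forcing
        ; clique        = encode ∘ copy ∘ proj₁ S.clique , tower-clique
        ; clique-bound  = λ v → tower-clique-bound (decode ∘ v)
        }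

    -- The last of the `k` levels is added explicitly, since it provides the `copy` that carries the
    -- clique.
    nextSystem : System (suc d) (k * m)
    nextSystem = Flatten.flattened extendedTower copy copy-R
      where open Extend (tower k′)

  -- The starting system: a chain of `k` vertices

  ChainR : Fin 1 → Rel (Fin k) 0ℓ
  ChainR _ = Fin._<_

  chain-joined : Pairwise (Joined ChainR) id
  chain-joined a b a≢b with <-cmp a b
  ... | tri< a<b _ _ = zero , inj₁ a<b
  ... | tri≈ _ a≡b _ = contradiction a≡b a≢b
  ... | tri> _ _ a>b = zero , inj₂ a>b

  chain-proper : Proper ChainR id
  chain-proper x<y x≡y = <-irrefl x≡y x<y

  chainSystem : System 1 k
  chainSystem = record
    { n             = k
    ; R             = ChainR
    ; R?            = λ _ → _<?_
    ; R-irrefl      = <-irrefl refl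
    ; R-trans       = <-trans
    ; point         = zero
    ; colour        = id
    ; colour-proper = λ {e} → chain-proper {e}
    ; forcing       = λ f f-proper →
        id , pairwise-injective id f (joined⇒≢ {R = ChainR} f (λ {e} → f-proper {e})) chain-joined
    ; clique        = id , chain-joined
    ; clique-bound  = λ v vJ → ℕ.1+n≰n (injective⇒≤
        (pairwise-injective v id (joined⇒≢ {R = ChainR} id (λ {e} → chain-proper {e})) vJ))
    }

  system : ∀ d → System (suc d) (k ^ suc d)
  -- `k ^ 1` unfolds to `k * 1`, not to `k`.
  system zero    = subst (System 1) (sym (ℕ.*-identityʳ k)) chainSystem
  system (suc d) = nextSystem (system d)

-- Cliques as subsets

elements : ∀ {n} (S : Subset n) → Fin ∣ S ∣ → Fin n
elements (inside  ∷ S) zero    = zero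
elements (inside  ∷ S) (suc i) = suc (elements S i)
elements (outside ∷ S) i       = suc (elements S i)

elements-injective : ∀ {n} (S : Subset n) → Injective _≡_ _≡_ (elements S)
elements-injective (inside  ∷ S) {zero}  {zero}  eq = refl
elements-injective (inside  ∷ S) {suc i} {suc j} eq =
  cong suc (elements-injective S (suc-injective eq))
elements-injective (outside ∷ S)                 eq = elements-injective S (suc-injective eq)

elements-∈ : ∀ {n} (S : Subset n) i → elements S i ∈ S
elements-∈ (inside  ∷ S) zero    = here
elements-∈ (inside  ∷ S) (suc i) = there (elements-∈ S i)
elements-∈ (outside ∷ S) i       = there (elements-∈ S i)

-- Removing `v zero` from `S` keeps the other values inside, by injectivity, and strictly lowers the
-- size.
injective⇒≤∣∣ : ∀ {r n} (v : Fin r → Fin n) → Injective _≡_ _≡_ v →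
                (S : Subset n) → (∀ a → v a ∈ S) → r ≤ ∣ S ∣
injective⇒≤∣∣ {zero}  v v-inj S v∈S = z≤n
injective⇒≤∣∣ {suc r} v v-inj S v∈S = ℕ.≤-<-trans
  (injective⇒≤∣∣ (v ∘ suc) (suc-injective ∘ v-inj) (S Subset.- v zero)
    λ a → x∈p∧x≢y⇒x∈p-y (v∈S (suc a)) λ eq → contradiction (v-inj eq) λ ())
  (x∈p⇒∣p-x∣<∣p∣ (v∈S zero))

image : ∀ {r n} → (Fin r → Fin n) → Subset n
image v = tabulate λ x → does (any? λ a → v a ≟ x)

∈-image : ∀ {r n} (v : Fin r → Fin n) a → v a ∈ image v
∈-image v a = lookup⇒[]= _ _
  (trans (lookup∘tabulate _ (v a)) (dec-true (any? λ b → v b ≟ v a) (a , refl)))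

∈-image⁻ : ∀ {r n} (v : Fin r → Fin n) {x} → x ∈ image v → ∃ λ a → v a ≡ x
∈-image⁻ v {x} x∈ with any? (λ a → v a ≟ x) | trans (sym (lookup∘tabulate _ x)) ([]=⇒lookup x∈)
... | yes a | _ = a

-- Graphs from a family of strict orders

module _ {n d : ℕ} (R : Fin d → Rel (Fin n) 0ℓ) (R? : ∀ e → Decidable (R e))
         (R-irrefl : ∀ {e x} → ¬ R e x x) (R-trans : ∀ {e} → Transitive (R e)) where

  comparabilityGraph : Fin d → Graph n
  comparabilityGraph e = record
    { V          = Subset.⊤
    ; Adj        = Comparable (R e)
    ; Adj?       = λ x y → R? e x y ⊎-dec R? e y x
    ; Adj-sym    = swap
    ; Adj-irrefl = λ { refl → [ R-irrefl , R-irrefl ]′ }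
    ; Adj⇒∈V     = λ _ → ∈⊤
    }

  unionGraph : Graph n
  unionGraph = record
    { V          = Subset.⊤
    ; Adj        = Joined R
    ; Adj?       = λ x y → any? λ e → R? e x y ⊎-dec R? e y x
    ; Adj-sym    = Joined-sym R
    ; Adj-irrefl = λ { refl (_ , r) → [ R-irrefl , R-irrefl ]′ r }
    ; Adj⇒∈V     = λ _ → ∈⊤
    }

  comparabilityGraph-isComparabilityGraph : ∀ e → IsComparabilityGraph (comparabilityGraph e)
  comparabilityGraph-isComparabilityGraph e =
    _≼_ , isPartialOrder isStrict , λ u v → mk⇔
      (λ r → (λ { refl → [ R-irrefl , R-irrefl ]′ r })
           , [ inj₁ ∘ inj₁ , inj₂ ∘ inj₁ ]′ r)
      (λ { (_   , inj₁ (inj₁ r))    → inj₁ r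
         ; (u≢v , inj₁ (inj₂ u≡v)) → contradiction u≡v u≢v
         ; (_   , inj₂ (inj₁ r))    → inj₂ r
         ; (u≢v , inj₂ (inj₂ v≡u)) → contradiction (sym v≡u) u≢v })
    where
    _≺_ : Rel (Graph.Vertex (comparabilityGraph e)) 0ℓ
    u ≺ v = R e (proj₁ u) (proj₁ v)

    isStrict : IsStrictPartialOrder _≡_ _≺_
    isStrict = record
      { isEquivalence = isEquivalence
      ; irrefl        = λ { refl → R-irrefl }
      ; trans         = R-trans
      ; <-resp-≈      = resp₂ _≺_
      }

    open StrictToNonStrict _≡_ _≺_ using (isPartialOrder) renaming (_≤_ to _≼_)

  -- The index `e` makes the vertex sets cover the union: each vertex has to lie in one of the `d`
  -- graphs, even if it is isolated.
  unionGraph-isUnion : Fin d → IsUnionOfComparabilityGraphs d unionGraph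
  unionGraph-isUnion e =
    comparabilityGraph , comparabilityGraph-isComparabilityGraph ,
    (λ x → mk⇔ (λ x∈ → e , x∈) (λ _ → ∈⊤)) ,
    (λ x y → mk⇔ id id)

  unionGraph-cliqueNumber : ∀ {k} → (∃ λ (v : Fin k → Fin n) → Pairwise (Joined R) v) →
                            (∀ (v : Fin (suc k) → Fin n) → ¬ Pairwise (Joined R) v) →
                            IsCliqueNumber unionGraph k
  unionGraph-cliqueNumber {k} (v , vJ) bound =
    -- The image is not counted directly: as a clique it has at most `k` elements, and by
    -- injectivity at least `k`.
    (image v , image-clique , ℕ.≤-antisym (upper (image v) image-clique)
      (injective⇒≤∣∣ v v-inj (image v) (∈-image v))) , upper
    where
    image-clique : IsClique unionGraph (image v)
    image-clique = (λ _ → ∈⊤) , adj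
      where
      adj : ∀ {x y} → x ∈ image v → y ∈ image v → x ≢ y → Joined R x y
      adj x∈ y∈ x≢y with a , refl ← ∈-image⁻ v x∈ | b , refl ← ∈-image⁻ v y∈ =
        vJ a b (x≢y ∘ cong v)

    v-inj : Injective _≡_ _≡_ v
    v-inj = pairwise-injective {R = Joined R} v id
      (λ xJy x≡y → Graph.Adj-irrefl unionGraph x≡y xJy) vJ

    upper : ∀ S → IsClique unionGraph S → ∣ S ∣ ≤ k
    -- The first `k + 1` elements of a larger clique would contradict `bound`.
    upper S (_ , adj) = ℕ.≮⇒≥ λ k<∣S∣ →
      bound (λ a → elements S (inject≤ a k<∣S∣)) λ a b a≢b →
        adj (elements-∈ S _) (elements-∈ S _)
            (a≢b ∘ inject≤-injective k<∣S∣ k<∣S∣ a b ∘ elements-injective S)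

theorem1 : (k d : ℕ) .{{_ : NonZero k}} .{{_ : NonZero d}} →
    Σ ℕ λ n → Σ (Graph n) λ G →
    IsUnionOfComparabilityGraphs d G ×
    IsCliqueNumber G k ×
    IsChromaticNumber G (k ^ d)
theorem1 (suc k′) (suc d′) = n , G , unionGraph-isUnion R R? R-irrefl R-trans zero ,
  unionGraph-cliqueNumber R R? R-irrefl R-trans clique clique-bound ,
  (colour ∘ proj₁ , λ u v → joined⇒≢ colour colour-proper) , lower
  where
  k d : ℕ
  k = suc k′
  d = suc d′

  -- Exactly `k ^ d` colours are allowed, as many as are to be forced; the constant word shows that
  -- there is a colour.
  open Construction k′ (k ^ d) (funToFin {d} λ _ → zero)
  open System (system d′)

  G : Graph n
  G = unionGraph R R? R-irrefl R-trans

  lower : ∀ c′ → Colourable G c′ → k ^ d ≤ c′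
  lower c′ (f , f-proper) with ℕ.≤-total (k ^ d) c′
  ... | inj₁ k^d≤c′ = k^d≤c′
  -- A colouring with fewer colours is read as one with `k ^ d` colours. The `k ^ d` distinct
  -- colours forced in it all come from `Fin c′`.
  ... | inj₂ c′≤k^d
    with y , y-inj ← forcing (λ x → inject≤ (f (x , ∈⊤)) c′≤k^d)
      (λ {e} r eq → f-proper (_ , ∈⊤) (_ , ∈⊤) (e , inj₁ r)
                               (inject≤-injective c′≤k^d c′≤k^d _ _ eq))
    = injective⇒≤ {f = λ b → f (y b , ∈⊤)} λ eq → y-inj (cong (λ z → inject≤ z c′≤k^d) eq)
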